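{- For every formula $\varphi$ from the left-flat fragment of $\mathrm{TeamLTL}(\lor_{\mathsf B},\overset{1}{\mathsf A})$, one can compute an equivalent $\overset{u}{\exists}{}_p^{*}\forall_\pi\,\mathrm{HyperQPTL}$ formula $\psi$ of size linear in the size of $\varphi$; here equivalence means that for every team $(T,i)$: $(T,i)\models\varphi$ iff $\emptyset,i\models_T\psi$.
   Context: $\mathrm{AP}$ is a fixed set of atomic propositions, containing fresh propositions (not occurring in the formula at hand) whenever needed. A trace is an element of $(2^{\mathrm{AP}})^\omega$, and $t[i]$ is its $i$-th letter. A team is a pair $(T,i)$ with $T$ a set of traces and $i\in\mathbb N$. $\mathrm{TeamLTL}(\lor_{\mathsf B},\overset{1}{\mathsf A})$ formulae are $\varphi ::= p \mid \neg p \mid \varphi\lor\varphi \mid \varphi\lor_{\mathsf B}\varphi\mid\varphi\land\varphi \mid \overset{1}{\mathsf A}\varphi\mid\mathsf X\varphi \mid \varphi\,\mathsf U\,\varphi \mid \varphi\,\mathsf W\,\varphi$ ($p\in\mathrm{AP}$), with semantics: - $(T,i)\models p$ iff $p\in t[i]$ for all $t\in T$; $(T,i)\models\neg p$ iff $p\notin t[i]$ for all $t\in T$; - $(T,i)\models\varphi\land\psi$ iff $(T,i)\models\varphi$ and $(T,i)\models\psi$; - $(T,i)\models\varphi\lor\psi$ iff there are $T_1,T_2$ with $T_1\cup T_2=T$, $(T_1,i)\models\varphi$ and $(T_2,i)\models\psi$; - $(T,i)\models\varphi\lor_{\mathsf B}\psi$ iff $(T,i)\models\varphi$ or $(T,i)\models\psi$;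 - $(T,i)\models\overset{1}{\mathsf A}\varphi$ iff $(\{t\},i)\models\varphi$ for all $t\in T$; - $(T,i)\models\mathsf X\varphi$ iff $(T,i+1)\models\varphi$; - $(T,i)\models\varphi\,\mathsf U\,\psi$ iff there is $k\ge i$ with $(T,k)\models\psi$ and $(T,m)\models\varphi$ for all $i\le m<k$; - $(T,i)\models\varphi\,\mathsf W\,\psi$ iff for all $k\ge i$: $(T,k)\models\varphi$ or there is $m$ with $i\le m\le k$ and $(T,m)\models\psi$. A formula $\varphi$ is flat if for every team $(T,i)$: $(T,i)\models\varphi$ iff $(\{t\},i)\models\varphi$ for all $t\in T$. A formula belongs to the left-flat fragment if in each of its subformulae of the form $\psi\,\mathsf U\,\varphi$ or $\psi\,\mathsf W\,\varphi$, the formula $\psi$ is flat. $\overset{u}{\exists}{}_p^{*}\forall_\pi\,\mathrm{HyperQPTL}$ consists of formulae $\overset{u}{\exists}q_1\dots\overset{u}{\exists}q_n.\forall\pi.\,\psi$ with $q_j\in\mathrm{AP}$, $\pi$ a trace variable, and $\psi ::= p_\pi\mid\neg p_\pi\mid\psi\lor\psi\mid\psi\land\psi\mid\mathsf X\psi\mid\psi\,\mathsf U\,\psi\mid\psi\,\mathsf W\,\psi$. Given a set $T$ of traces and a (possibly empty, $\emptyset$) assignment $\Pi$ of traces in $T$ to trace variables: $\Pi,i\models_T p_\pi$ iff $p\in\Pi(\pi)[i]$; $\Pi,i\models_T\neg p_\pi$ iff $p\notin\Pi(\pi)[i]$; Boolean connectives and $\mathsf X,\mathsf U,\mathsf W$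 are interpreted as usual in LTL with respect to the position $i$; $\Pi,i\models_T\forall\pi.\varphi$ iff $\Pi[\pi\mapsto t],i\models_T\varphi$ for all $t\in T$; and $\Pi,i\models_T\overset{u}{\exists}q.\varphi$ iff $\Pi[q\mapsto s],i\models_{T[q\mapsto s]}\varphi$ for some $s\in(2^{\{q\}})^\omega$, where $T[q\mapsto s]$ and $\Pi[q\mapsto s]$ are obtained by reinterpreting $q$ on every trace as in $s$, leaving all other propositions unchanged. -}

module Defs where

open import Level using (0ℓ; Lift) renaming (suc to lsuc)
open import Data.Bool using (Bool; true; false; if_then_else_)
open import Data.Nat using (ℕ; suc; _+_; _≤_; _<_)
open import Data.Fin using (Fin)
open import Data.List using (List)
open import Data.List.Membership.Propositional using () renaming (_∉_ to _∉ₗ_)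
open import Data.Product using (∃; ∃₂; _×_)
open import Data.Sum using (_⊎_)
open import Data.Vec using (Vec; []; _∷_; lookup; map)
open import Function.Bundles using (_⇔_)
open import Relation.Binary.Construct.Closure.ReflexiveTransitive using (Star)
open import Relation.Binary.Definitions using (DecidableEquality)
open import Relation.Binary.PropositionalEquality using (_≡_)
open import Relation.Nullary using (does)
open import Relation.Unary using (Pred; _∈_; _∪_; _≐_; ｛_｝)

-- For any finite list of propositions there is one outside it.
HasFresh : Set → Set
HasFresh AP = (ps : List AP) → ∃ λ p → p ∉ₗ ps

module Logics (AP : Set) (_≟_ : DecidableEquality AP) where

  -- Elements of 2^AP are characteristic functions: p belongs to the i-th
  -- letter of t when t i p ≡ true.
  Trace : Set
  Trace = ℕ → AP → Bool

  Traces : Set₁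
  Traces = Pred Trace 0ℓ

  ----------------------------------------------------------------------
  -- TeamLTL(∨_B, A¹)

  infixr 7 _∧_
  infixr 6 _∨_ _∨ᴮ_
  infixr 5 _U_ _W_

  data TeamLTL : Set where
    atom  : AP → TeamLTL
    ¬atom : AP → TeamLTL
    _∨_   : TeamLTL → TeamLTL → TeamLTL
    _∨ᴮ_  : TeamLTL → TeamLTL → TeamLTL
    _∧_   : TeamLTL → TeamLTL → TeamLTL
    A¹    : TeamLTL → TeamLTL
    X     : TeamLTL → TeamLTL
    _U_   : TeamLTL → TeamLTL → TeamLTL
    _W_   : TeamLTL → TeamLTL → TeamLTL

  infix 4 _,_⊨_

  _,_⊨_ : Traces → ℕ → TeamLTL → Set₁
  T , i ⊨ atom p  = Lift (lsuc 0ℓ) (∀ t → t ∈ T → t i p ≡ true)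
  T , i ⊨ ¬atom p = Lift (lsuc 0ℓ) (∀ t → t ∈ T → t i p ≡ false)
  T , i ⊨ φ ∨ ψ   = ∃₂ λ (T₁ T₂ : Traces) →
                      (T₁ ∪ T₂) ≐ T × T₁ , i ⊨ φ × T₂ , i ⊨ ψ
  T , i ⊨ φ ∨ᴮ ψ  = T , i ⊨ φ ⊎ T , i ⊨ ψ
  T , i ⊨ φ ∧ ψ   = T , i ⊨ φ × T , i ⊨ ψ
  T , i ⊨ A¹ φ    = ∀ t → t ∈ T → ｛ t ｝ , i ⊨ φ
  T , i ⊨ X φ     = T , suc i ⊨ φ
  T , i ⊨ φ U ψ   = ∃ λ k → i ≤ k × T , k ⊨ ψ ×
                      (∀ m → i ≤ m → m < k → T , m ⊨ φ)
  T , i ⊨ φ W ψ   = ∀ k → i ≤ k →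
                      T , k ⊨ φ ⊎ (∃ λ m → i ≤ m × m ≤ k × T , m ⊨ ψ)

  Flat : TeamLTL → Set₁
  Flat φ = ∀ (T : Traces) i → T , i ⊨ φ ⇔ (∀ t → t ∈ T → ｛ t ｝ , i ⊨ φ)

  -- φ ◁ ψ : φ is an immediate subformula of ψ.
  infix 4 _◁_ _⊑_

  data _◁_ : TeamLTL → TeamLTL → Set where
    ∨ˡ  : ∀ {φ ψ} → φ ◁ φ ∨ ψ
    ∨ʳ  : ∀ {φ ψ} → ψ ◁ φ ∨ ψ
    ∨ᴮˡ : ∀ {φ ψ} → φ ◁ φ ∨ᴮ ψ
    ∨ᴮʳ : ∀ {φ ψ} → ψ ◁ φ ∨ᴮ ψ
    ∧ˡ  : ∀ {φ ψ} → φ ◁ φ ∧ ψ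
    ∧ʳ  : ∀ {φ ψ} → ψ ◁ φ ∧ ψ
    A¹ᵃ : ∀ {φ}   → φ ◁ A¹ φ
    Xᵃ  : ∀ {φ}   → φ ◁ X φ
    Uˡ  : ∀ {φ ψ} → φ ◁ φ U ψ
    Uʳ  : ∀ {φ ψ} → ψ ◁ φ U ψ
    Wˡ  : ∀ {φ ψ} → φ ◁ φ W ψ
    Wʳ  : ∀ {φ ψ} → ψ ◁ φ W ψ

  _⊑_ : TeamLTL → TeamLTL → Set
  _⊑_ = Star _◁_

  LeftFlat : TeamLTL → Set₁
  LeftFlat χ = ∀ ψ φ → (ψ U φ ⊑ χ → Flat ψ) × (ψ W φ ⊑ χ → Flat ψ)

  size : TeamLTL → ℕ
  size (atom _)  = 1
  size (¬atom _) = 1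
  size (φ ∨ ψ)   = 1 + size φ + size ψ
  size (φ ∨ᴮ ψ)  = 1 + size φ + size ψ
  size (φ ∧ ψ)   = 1 + size φ + size ψ
  size (A¹ φ)    = 1 + size φ
  size (X φ)     = 1 + size φ
  size (φ U ψ)   = 1 + size φ + size ψ
  size (φ W ψ)   = 1 + size φ + size ψ

  ----------------------------------------------------------------------
  -- HyperQPTL

  -- Trace variables are de Bruijn indices; an assignment for n variables
  -- is a vector of n traces, so the empty assignment is [].
  Assignment : ℕ → Set
  Assignment n = Vec Trace n

  data Matrix (n : ℕ) : Set where
    atom  : AP → Fin n → Matrix n
    ¬atom : AP → Fin n → Matrix n
    _∨_   : Matrix n → Matrix n → Matrix n
    _∧_   : Matrix n → Matrix n → Matrix n
    X     : Matrix n → Matrix n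
    _U_   : Matrix n → Matrix n → Matrix n
    _W_   : Matrix n → Matrix n → Matrix n

  data Prenex (n : ℕ) : Set where
    ∃ᵘ : AP → Prenex n → Prenex n
    ∀π : Matrix (suc n) → Prenex n

  -- Closed formulae ∃ᵘ q₁ … ∃ᵘ qₙ . ∀ π . ψ : the only trace variable that
  -- can occur in ψ is π.
  ∃*∀HyperQPTL : Set
  ∃*∀HyperQPTL = Prenex 0

  infix 8 _[_↦_] _[_↦_]ᵀ

  -- An element of (2^{q})^ω is a sequence of truth values for q.
  _[_↦_] : Trace → AP → (ℕ → Bool) → Trace
  (t [ q ↦ s ]) i p = if does (p ≟ q) then s i else t i p

  _[_↦_]ᵀ : Traces → AP → (ℕ → Bool) → Traces
  (T [ q ↦ s ]ᵀ) t′ = ∃ λ t → t ∈ T × t [ q ↦ s ] ≡ t′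

  infix 4 _,_⊨ᴹ_ _,_⊨[_]_

  -- The set of traces is irrelevant for quantifier-free formulae.
  _,_⊨ᴹ_ : ∀ {n} → Assignment n → ℕ → Matrix n → Set
  Π , i ⊨ᴹ atom p π  = lookup Π π i p ≡ true
  Π , i ⊨ᴹ ¬atom p π = lookup Π π i p ≡ false
  Π , i ⊨ᴹ φ ∨ ψ     = Π , i ⊨ᴹ φ ⊎ Π , i ⊨ᴹ ψ
  Π , i ⊨ᴹ φ ∧ ψ     = Π , i ⊨ᴹ φ × Π , i ⊨ᴹ ψ
  Π , i ⊨ᴹ X φ       = Π , suc i ⊨ᴹ φ
  Π , i ⊨ᴹ φ U ψ     = ∃ λ k → i ≤ k × Π , k ⊨ᴹ ψ ×
                         (∀ m → i ≤ m → m < k → Π , m ⊨ᴹ φ)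
  Π , i ⊨ᴹ φ W ψ     = ∀ k → i ≤ k →
                         Π , k ⊨ᴹ φ ⊎ (∃ λ m → i ≤ m × m ≤ k × Π , m ⊨ᴹ ψ)

  _,_⊨[_]_ : ∀ {n} → Assignment n → ℕ → Traces → Prenex n → Set
  Π , i ⊨[ T ] ∃ᵘ q φ = ∃ λ s → map _[ q ↦ s ] Π , i ⊨[ T [ q ↦ s ]ᵀ ] φ
  Π , i ⊨[ T ] ∀π ψ   = ∀ t → t ∈ T → (t ∷ Π) , i ⊨ᴹ ψ

  sizeᴹ : ∀ {n} → Matrix n → ℕ
  sizeᴹ (atom _ _)  = 1
  sizeᴹ (¬atom _ _) = 1
  sizeᴹ (φ ∨ ψ)     = 1 + sizeᴹ φ + sizeᴹ ψ
  sizeᴹ (φ ∧ ψ)     = 1 + sizeᴹ φ + sizeᴹ ψ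
  sizeᴹ (X φ)       = 1 + sizeᴹ φ
  sizeᴹ (φ U ψ)     = 1 + sizeᴹ φ + sizeᴹ ψ
  sizeᴹ (φ W ψ)     = 1 + sizeᴹ φ + sizeᴹ ψ

  sizeᴴ : ∀ {n} → Prenex n → ℕ
  sizeᴴ (∃ᵘ _ φ) = 1 + sizeᴴ φ
  sizeᴴ (∀π ψ)   = 1 + sizeᴹ ψ

  Equivalent : TeamLTL → ∃*∀HyperQPTL → Set₁
  Equivalent φ ψ = ∀ (T : Traces) i → T , i ⊨ φ ⇔ [] , i ⊨[ T ] ψ

{-# OPTIONS --safe #-}
-- On a singleton team every formula collapses to an LTL formula (∨ᴮ becomes
-- ∨ and A¹ disappears), so flat formulae and formulae below A¹ are checked
-- trace by trace.  The only choices in a left-flat formula that all traces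
-- have to share are the disjunct picked by a ∨ᴮ and the witness position of a
-- U or W.  Each of them is stored in a fresh proposition q, uniformly
-- quantified: φ ∨ᴮ ψ becomes (q ∧ φ) ∨ (¬q ∧ ψ), and φ U ψ becomes
-- (¬q ∧ φ) U (q ∧ ψ), which forces all traces to take the first position with
-- q as their witness.  The splitting disjunction needs no choice, as the two
-- subteams can be recovered as the traces satisfying either disjunct.
module Submission where

open import Defs
open import Level using (Level; 0ℓ; lift; lower; Lift) renaming (suc to lsuc)
open import Axiom.ExcludedMiddle using (ExcludedMiddle)
open import Data.Bool using (Bool; true; false)
open import Data.Empty using (⊥; ⊥-elim)
open import Data.Fin using (zero)
open import Data.List using (List; []; _∷_) renaming (_++_ to _++ₗ_)
open import Data.List.Membership.Propositional using () renaming (_∈_ to _∈ₗ_)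
open import Data.List.Membership.Propositional.Properties using (∈-++⁺ˡ; ∈-++⁺ʳ)
open import Data.List.Relation.Unary.Any using (here; there)
open import Data.Nat using (ℕ; zero; suc; _+_; _*_; _≤_; _<_; z≤n; s≤s; _≟_; _≤?_)
open import Data.Nat.Induction using (<-rec)
open import Data.Nat.Properties
open import Data.Nat.Tactic.RingSolver using (solve-∀)
open import Data.Product using (∃; ∃-syntax; Σ-syntax; _×_; _,_; proj₁; proj₂; map₂)
open import Data.Product.Function.NonDependent.Propositional using (_×-⇔_)
open import Data.Sum using (_⊎_; inj₁; inj₂; [_,_]; [_,_]′) renaming (map to ⊎-map)
open import Data.Sum.Function.Propositional using (_⊎-⇔_)
open import Data.Vec using (Vec; []; _∷_; _++_; take; drop; replicate)
open import Data.Vec.Properties using (take++drop≡id; ++-injective)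
open import Data.Vec.Relation.Binary.Pointwise.Inductive using (Pointwise; []; _∷_)
open import Function using (_∘_; const; id)
open import Function.Bundles using (_⇔_; mk⇔; Equivalence)
open import Function.Construct.Composition using (_⇔-∘_)
open import Function.Construct.Symmetry using (⇔-sym)
open import Relation.Binary.Construct.Closure.ReflexiveTransitive using (_◅◅_; _◅_; ε)
open import Relation.Binary.Definitions using (DecidableEquality; tri<; tri≈; tri>)
open import Relation.Binary.PropositionalEquality using (_≡_; _≢_; refl; sym; trans; cong; subst)
open import Relation.Nullary using (yes; no; does; ¬_; contradiction)
open import Relation.Nullary.Decidable using (dec-true; dec-false)
open import Relation.Unary using (_∈_; _∉_; _⊆_; _∩_; ｛_｝)

private
  variable
    a b c d : Level

open Equivalence using (to; from)

≡-cong-⇔ : {A : Set a} {x y z : A} → x ≡ y → (x ≡ z) ⇔ (y ≡ z)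
≡-cong-⇔ refl = mk⇔ id id

true≢false : ∀ {x} → x ≡ true → ¬ x ≡ false
true≢false refl ()

-- Linear time

Until : (ℕ → Set a) → (ℕ → Set b) → ℕ → Set _
Until P Q i = ∃ λ k → i ≤ k × Q k × (∀ m → i ≤ m → m < k → P m)

Unless : (ℕ → Set a) → (ℕ → Set b) → ℕ → Set _
Unless P Q i = ∀ k → i ≤ k → P k ⊎ (∃ λ m → i ≤ m × m ≤ k × Q m)

module _ {P : ℕ → Set a} {Q : ℕ → Set b} {P′ : ℕ → Set c} {Q′ : ℕ → Set d} where

  Until-map : (∀ k → P k → P′ k) → (∀ k → Q k → Q′ k) →
              ∀ {i} → Until P Q i → Until P′ Q′ i
  Until-map f g (k , i≤k , q , ps) = k , i≤k , g k q , λ m i≤m m<k → f m (ps m i≤m m<k)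

  Unless-map : (∀ k → P k → P′ k) → (∀ k → Q k → Q′ k) →
               ∀ {i} → Unless P Q i → Unless P′ Q′ i
  Unless-map f g w k i≤k = ⊎-map (f k) (map₂ (map₂ (map₂ (g _)))) (w k i≤k)

module _ {P : ℕ → Set a} {Q : ℕ → Set b} {P′ : ℕ → Set c} {Q′ : ℕ → Set d} where

  Until-cong : (∀ k → P k ⇔ P′ k) → (∀ k → Q k ⇔ Q′ k) →
               ∀ {i} → Until P Q i ⇔ Until P′ Q′ i
  Until-cong f g = mk⇔ (Until-map (to ∘ f) (to ∘ g)) (Until-map (from ∘ f) (from ∘ g))

  Unless-cong : (∀ k → P k ⇔ P′ k) → (∀ k → Q k ⇔ Q′ k) →
                ∀ {i} → Unless P Q i ⇔ Unless P′ Q′ i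
  Unless-cong f g = mk⇔ (Unless-map (to ∘ f) (to ∘ g)) (Unless-map (from ∘ f) (from ∘ g))

module _ {P : ℕ → Set a} {Q : ℕ → Set b} where

  Until⇒Unless : ∀ {i} → Until P Q i → Unless P Q i
  Until⇒Unless (m , i≤m , q , ps) k i≤k with m ≤? k
  ... | yes m≤k = inj₂ (m , i≤m , m≤k , q)
  ... | no  m≰k = inj₁ (ps k i≤k (≰⇒> m≰k))

  -- Strong induction: an occurrence of `Q` at some `m ≤ k` would, with `P` already known at all
  -- earlier positions from `i` on, complete an `Until`, which is excluded. This is the mode of a
  -- weak until in which `P` holds forever.
  Unless-¬Until : ∀ {i} → Unless P Q i → ¬ Until P Q i → ∀ k → i ≤ k → P k
  Unless-¬Until {i} w ¬u = <-rec _ step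
    where
    step : ∀ k → (∀ {j} → j < k → i ≤ j → P j) → i ≤ k → P k
    step k rec i≤k with w k i≤k
    ... | inj₁ p = p
    ... | inj₂ (m , i≤m , m≤k , q) =
      contradiction (m , i≤m , q , λ j i≤j j<m → rec (<-≤-trans j<m m≤k) i≤j) ¬u

-- The position to which the guards in `body` pin an until: the witness carries the choice bit and
-- every earlier position refutes it, so traces sharing `s` share the witness.
First : (ℕ → Bool) → ℕ → ℕ → Set
First s i k = i ≤ k × s k ≡ true × (∀ j → i ≤ j → j < k → s j ≡ false)

First-unique : ∀ {s i k l} → First s i k → First s i l → k ≡ l
First-unique {k = k} {l} (i≤k , sk , ¬s<k) (i≤l , sl , ¬s<l) with <-cmp k l
... | tri< k<l _ _ = contradiction (¬s<l k i≤k k<l) (true≢false sk)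
... | tri≈ _ k≡l _ = k≡l
... | tri> _ _ l<k = contradiction (¬s<k l i≤l l<k) (true≢false sl)

-- The search stops below `v`, which keeps it decidable; `Sat⇒⊨` uses it at a weak until, where `s`
-- may never become true.
first? : ∀ s i v → (∃ λ j → j < v × First s i j) ⊎ (∀ j → i ≤ j → j < v → s j ≡ false)
first? s i zero = inj₂ λ _ _ ()
first? s i (suc v) with first? s i v | i ≤? v | s v in sv
... | inj₁ (j , j<v , f) | _       | _     = inj₁ (j , m<n⇒m<1+n j<v , f)
... | inj₂ none          | yes i≤v | true  = inj₁ (v , ≤-refl , i≤v , sv , none)
... | inj₂ none          | no i≰v  | _     =
  inj₂ λ j i≤j j≤v → contradiction (≤-trans i≤j (≤-pred j≤v)) i≰v
... | inj₂ none          | yes _   | false =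
  inj₂ λ j i≤j j≤v → [ none j i≤j , (λ { refl → sv }) ] (m<1+n⇒m<n∨m≡n j≤v)

-- Splitting vectors

module _ {A : Set a} {m n} (xs : Vec A m) (ys : Vec A n) where

  private
    split : take m (xs ++ ys) ≡ xs × drop m (xs ++ ys) ≡ ys
    split = ++-injective _ _ (take++drop≡id m (xs ++ ys))

  take-++ : take m (xs ++ ys) ≡ xs
  take-++ = proj₁ split

  drop-++ : drop m (xs ++ ys) ≡ ys
  drop-++ = proj₂ split

module _ {A : Set a} {B : Set b} {R : A → B → Set c} where

  Pointwise-take : ∀ m {n} {xs : Vec A (m + n)} {ys : Vec B (m + n)} →
                   Pointwise R xs ys → Pointwise R (take m xs) (take m ys)
  Pointwise-take zero    rs       = []
  Pointwise-take (suc m) (r ∷ rs) = r ∷ Pointwise-take m rs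

  Pointwise-drop : ∀ m {n} {xs : Vec A (m + n)} {ys : Vec B (m + n)} →
                   Pointwise R xs ys → Pointwise R (drop m xs) (drop m ys)
  Pointwise-drop zero    rs       = rs
  Pointwise-drop (suc m) (r ∷ rs) = Pointwise-drop m rs

module Translation (AP : Set) (_≟ᴬ_ : DecidableEquality AP) where

  open Logics AP _≟ᴬ_

  private
    variable
      φ ψ : TeamLTL
      T T′ : Traces
      t t′ : Trace
      n : ℕ

  Seq : Set
  Seq = ℕ → Bool

  -- Team semantics

  -- Supplies the empty half of a split, and covers a team with no trace from which the witness of
  -- an until could be read.
  ⊨-∅ : ∀ φ {i} → (∀ t → t ∉ T) → T , i ⊨ φ
  ⊨-∅ (atom p)  ∅ = lift λ t t∈T → ⊥-elim (∅ t t∈T)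
  ⊨-∅ (¬atom p) ∅ = lift λ t t∈T → ⊥-elim (∅ t t∈T)
  ⊨-∅ {T = T} (φ ∨ ψ) ∅ = T , T , ([ id , id ] , inj₁) , ⊨-∅ φ ∅ , ⊨-∅ ψ ∅
  ⊨-∅ (φ ∨ᴮ ψ)  ∅ = inj₁ (⊨-∅ φ ∅)
  ⊨-∅ (φ ∧ ψ)   ∅ = ⊨-∅ φ ∅ , ⊨-∅ ψ ∅
  ⊨-∅ (A¹ φ)    ∅ = λ t t∈T → ⊥-elim (∅ t t∈T)
  ⊨-∅ (X φ)     ∅ = ⊨-∅ φ ∅
  ⊨-∅ (φ U ψ) {i} ∅ = i , ≤-refl , ⊨-∅ ψ ∅ , λ m _ _ → ⊨-∅ φ ∅
  ⊨-∅ (φ W ψ)   ∅ = λ k _ → inj₁ (⊨-∅ φ ∅)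

  -- Downward closure: a split is inherited by intersecting both halves with the smaller team, and
  -- the witnesses of all other operators are kept.
  ⊨-⊆ : ∀ φ {i} → T′ ⊆ T → T , i ⊨ φ → T′ , i ⊨ φ
  ⊨-⊆ (atom p)  T′⊆T (lift h) = lift λ t → h t ∘ T′⊆T
  ⊨-⊆ (¬atom p) T′⊆T (lift h) = lift λ t → h t ∘ T′⊆T
  ⊨-⊆ {T′ = T′} (φ ∨ ψ) T′⊆T (T₁ , T₂ , (_ , T⊆) , h₁ , h₂) =
    T′ ∩ T₁ , T′ ∩ T₂ ,
    ([ proj₁ , proj₁ ] , λ t∈T′ → ⊎-map (t∈T′ ,_) (t∈T′ ,_) (T⊆ (T′⊆T t∈T′))) ,
    ⊨-⊆ φ proj₂ h₁ , ⊨-⊆ ψ proj₂ h₂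
  ⊨-⊆ (φ ∨ᴮ ψ)  T′⊆T = ⊎-map (⊨-⊆ φ T′⊆T) (⊨-⊆ ψ T′⊆T)
  ⊨-⊆ (φ ∧ ψ)   T′⊆T (h₁ , h₂) = ⊨-⊆ φ T′⊆T h₁ , ⊨-⊆ ψ T′⊆T h₂
  ⊨-⊆ (A¹ φ)    T′⊆T h = λ t → h t ∘ T′⊆T
  ⊨-⊆ (X φ)     T′⊆T h = ⊨-⊆ φ T′⊆T h
  ⊨-⊆ (φ U ψ)   T′⊆T h = Until-map (λ _ → ⊨-⊆ φ T′⊆T) (λ _ → ⊨-⊆ ψ T′⊆T) h
  ⊨-⊆ (φ W ψ)   T′⊆T h = Unless-map (λ _ → ⊨-⊆ φ T′⊆T) (λ _ → ⊨-⊆ ψ T′⊆T) h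

  -- Singleton teams

  ltl : TeamLTL → Matrix 1
  ltl (atom p)  = atom p zero
  ltl (¬atom p) = ¬atom p zero
  ltl (φ ∨ ψ)   = ltl φ ∨ ltl ψ
  ltl (φ ∨ᴮ ψ)  = ltl φ ∨ ltl ψ
  ltl (φ ∧ ψ)   = ltl φ ∧ ltl ψ
  ltl (A¹ φ)    = ltl φ
  ltl (X φ)     = X (ltl φ)
  ltl (φ U ψ)   = ltl φ U ltl ψ
  ltl (φ W ψ)   = ltl φ W ltl ψ

  props : TeamLTL → List AP
  props (atom p)  = p ∷ []
  props (¬atom p) = p ∷ []
  props (φ ∨ ψ)   = props φ ++ₗ props ψ
  props (φ ∨ᴮ ψ)  = props φ ++ₗ props ψ
  props (φ ∧ ψ)   = props φ ++ₗ props ψ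
  props (A¹ φ)    = props φ
  props (X φ)     = props φ
  props (φ U ψ)   = props φ ++ₗ props ψ
  props (φ W ψ)   = props φ ++ₗ props ψ

  -- Restricted to listed propositions, since overriding the fresh ones changes the trace but not
  -- what the formula can see of it.
  Agree : List AP → Trace → Trace → Set
  Agree ps t t′ = ∀ {p} → p ∈ₗ ps → ∀ i → t i p ≡ t′ i p

  Agree-++ˡ : ∀ {ps qs} → Agree (ps ++ₗ qs) t t′ → Agree ps t t′
  Agree-++ˡ ag = ag ∘ ∈-++⁺ˡ

  Agree-++ʳ : ∀ ps {qs} → Agree (ps ++ₗ qs) t t′ → Agree qs t t′
  Agree-++ʳ ps ag = ag ∘ ∈-++⁺ʳ ps


  singleton-∨ : ∀ φ ψ {i} → ｛ t ｝ , i ⊨ φ ∨ ψ ⇔ (｛ t ｝ , i ⊨ φ ⊎ ｛ t ｝ , i ⊨ ψ)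
  singleton-∨ {t = t} φ ψ {i} = mk⇔ ⇒ ⇐
    where
    ⇒ : ｛ t ｝ , i ⊨ φ ∨ ψ → ｛ t ｝ , i ⊨ φ ⊎ ｛ t ｝ , i ⊨ ψ
    ⇒ (T₁ , T₂ , (_ , t⊆) , h₁ , h₂) =
      ⊎-map (λ t∈T₁ → ⊨-⊆ φ (λ { refl → t∈T₁ }) h₁) (λ t∈T₂ → ⊨-⊆ ψ (λ { refl → t∈T₂ }) h₂)
            (t⊆ refl)

    ∅ : Traces
    ∅ _ = ⊥

    ⇐ : ｛ t ｝ , i ⊨ φ ⊎ ｛ t ｝ , i ⊨ ψ → ｛ t ｝ , i ⊨ φ ∨ ψ
    ⇐ (inj₁ h) = ｛ t ｝ , ∅ , ([ id , ⊥-elim ] , inj₁) , h , ⊨-∅ ψ (λ _ ())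
    ⇐ (inj₂ h) = ∅ , ｛ t ｝ , ([ ⊥-elim , id ] , inj₂) , ⊨-∅ φ (λ _ ()) , h

  -- Two traces are allowed so that one induction serves twice: `t′ = t` gives the collapse to LTL,
  -- and chaining two instances gives invariance of `ltl φ` under changes outside `props φ`.
  ltl-correct : ∀ φ → Agree (props φ) t t′ → ∀ i → ｛ t ｝ , i ⊨ φ ⇔ (t′ ∷ []) , i ⊨ᴹ ltl φ
  ltl-correct (atom p) ag i =
    ≡-cong-⇔ (ag (here refl) i) ⇔-∘ mk⇔ (λ h → lower h _ refl) (λ h → lift λ { _ refl → h })
  ltl-correct (¬atom p) ag i =
    ≡-cong-⇔ (ag (here refl) i) ⇔-∘ mk⇔ (λ h → lower h _ refl) (λ h → lift λ { _ refl → h })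
  ltl-correct (φ ∨ ψ) ag i =
    (ltl-correct φ (Agree-++ˡ ag) i ⊎-⇔ ltl-correct ψ (Agree-++ʳ (props φ) ag) i)
      ⇔-∘ singleton-∨ φ ψ
  ltl-correct (φ ∨ᴮ ψ) ag i =
    ltl-correct φ (Agree-++ˡ ag) i ⊎-⇔ ltl-correct ψ (Agree-++ʳ (props φ) ag) i
  ltl-correct (φ ∧ ψ) ag i =
    ltl-correct φ (Agree-++ˡ ag) i ×-⇔ ltl-correct ψ (Agree-++ʳ (props φ) ag) i
  ltl-correct (A¹ φ) ag i = ltl-correct φ ag i ⇔-∘ mk⇔ (λ h → h _ refl) (λ { h _ refl → h })
  ltl-correct (X φ) ag i = ltl-correct φ ag (suc i)
  ltl-correct (φ U ψ) ag i =
    Until-cong (ltl-correct φ (Agree-++ˡ ag)) (ltl-correct ψ (Agree-++ʳ (props φ) ag))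
  ltl-correct (φ W ψ) ag i =
    Unless-cong (ltl-correct φ (Agree-++ˡ ag)) (ltl-correct ψ (Agree-++ʳ (props φ) ag))

  ltl-self : ∀ φ t i → ｛ t ｝ , i ⊨ φ ⇔ (t ∷ []) , i ⊨ᴹ ltl φ
  ltl-self φ t = ltl-correct φ (λ _ _ → refl)

  ltl-cong : ∀ φ → Agree (props φ) t t′ →
             ∀ i → (t ∷ []) , i ⊨ᴹ ltl φ ⇔ (t′ ∷ []) , i ⊨ᴹ ltl φ
  ltl-cong φ ag i = ltl-correct φ ag i ⇔-∘ ⇔-sym (ltl-self φ _ i)

  Flat-ltl : ∀ φ → Flat φ → ∀ T i → T , i ⊨ φ ⇔ (∀ t → t ∈ T → (t ∷ []) , i ⊨ᴹ ltl φ)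
  Flat-ltl φ flat T i =
    mk⇔ (λ h t t∈T → to (ltl-self φ t i) (h t t∈T)) (λ h t t∈T → from (ltl-self φ t i) (h t t∈T))
      ⇔-∘ flat T i

  LeftFlat-◁ : φ ◁ ψ → LeftFlat ψ → LeftFlat φ
  LeftFlat-◁ φ◁ψ lf χ θ =
    (λ s → proj₁ (lf χ θ) (s ◅◅ φ◁ψ ◅ ε)) , (λ s → proj₂ (lf χ θ) (s ◅◅ φ◁ψ ◅ ε))

  -- Uniform choices

  -- One sequence per occurrence suffices because the right argument of an until need only be
  -- evaluated by the whole team at a single position. Left arguments and bodies of `A¹` go through
  -- `ltl`, trace by trace, and contribute nothing.
  choices : TeamLTL → ℕ
  choices (atom _)  = 0
  choices (¬atom _) = 0
  choices (φ ∨ ψ)   = choices φ + choices ψ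
  choices (φ ∨ᴮ ψ)  = suc (choices φ + choices ψ)
  choices (φ ∧ ψ)   = choices φ + choices ψ
  choices (A¹ φ)    = 0
  choices (X φ)     = choices φ
  choices (φ U ψ)   = suc (choices ψ)
  choices (φ W ψ)   = suc (choices ψ)

  body : ∀ φ → Vec AP (choices φ) → Matrix 1
  body (atom p)  qs = atom p zero
  body (¬atom p) qs = ¬atom p zero
  body (φ ∨ ψ)   qs = body φ (take (choices φ) qs) ∨ body ψ (drop (choices φ) qs)
  body (φ ∨ᴮ ψ)  (q ∷ qs) = (atom q zero ∧ body φ (take (choices φ) qs))
                          ∨ (¬atom q zero ∧ body ψ (drop (choices φ) qs))
  body (φ ∧ ψ)   qs = body φ (take (choices φ) qs) ∧ body ψ (drop (choices φ) qs)
  body (A¹ φ)    qs = ltl φ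
  body (X φ)     qs = X (body φ qs)
  body (φ U ψ)   (q ∷ qs) = (¬atom q zero ∧ ltl φ) U (atom q zero ∧ body ψ qs)
  body (φ W ψ)   (q ∷ qs) = (¬atom q zero ∧ ltl φ) W (atom q zero ∧ body ψ qs)

  -- The meaning of the matrix when the choices are read from a vector of
  -- sequences instead of being encoded in the trace.
  Sat : ∀ φ → Vec Seq (choices φ) → Trace → ℕ → Set
  Sat (atom p)  e t i = t i p ≡ true
  Sat (¬atom p) e t i = t i p ≡ false
  Sat (φ ∨ ψ)   e t i = Sat φ (take (choices φ) e) t i ⊎ Sat ψ (drop (choices φ) e) t i
  Sat (φ ∨ᴮ ψ)  (s ∷ e) t i = (s i ≡ true × Sat φ (take (choices φ) e) t i)
                            ⊎ (s i ≡ false × Sat ψ (drop (choices φ) e) t i)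
  Sat (φ ∧ ψ)   e t i = Sat φ (take (choices φ) e) t i × Sat ψ (drop (choices φ) e) t i
  Sat (A¹ φ)    e t i = (t ∷ []) , i ⊨ᴹ ltl φ
  Sat (X φ)     e t i = Sat φ e t (suc i)
  Sat (φ U ψ)   (s ∷ e) t i = Until  (λ m → s m ≡ false × (t ∷ []) , m ⊨ᴹ ltl φ)
                                     (λ k → s k ≡ true × Sat ψ e t k) i
  Sat (φ W ψ)   (s ∷ e) t i = Unless (λ m → s m ≡ false × (t ∷ []) , m ⊨ᴹ ltl φ)
                                     (λ k → s k ≡ true × Sat ψ e t k) i

  Reads : Trace → Vec AP n → Vec Seq n → Set
  Reads t = Pointwise (λ q s → ∀ i → t i q ≡ s i)

  -- The matrix is read on the overridden trace `t′`, while `Sat` stays on the original `t`: `ag`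
  -- relates the old propositions and `rd` the fresh ones.
  body-correct : ∀ φ {qs e} → Agree (props φ) t t′ → Reads t′ qs e →
                 ∀ i → Sat φ e t i ⇔ (t′ ∷ []) , i ⊨ᴹ body φ qs
  body-correct (atom p)  ag rd i = ≡-cong-⇔ (ag (here refl) i)
  body-correct (¬atom p) ag rd i = ≡-cong-⇔ (ag (here refl) i)
  body-correct (φ ∨ ψ) ag rd i =
    body-correct φ (Agree-++ˡ ag) (Pointwise-take (choices φ) rd) i
      ⊎-⇔ body-correct ψ (Agree-++ʳ (props φ) ag) (Pointwise-drop (choices φ) rd) i
  body-correct (φ ∨ᴮ ψ) {_ ∷ _} {_ ∷ _} ag (r ∷ rd) i =
    (≡-cong-⇔ (sym (r i)) ×-⇔ body-correct φ (Agree-++ˡ ag) (Pointwise-take (choices φ) rd) i)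
      ⊎-⇔ (≡-cong-⇔ (sym (r i)) ×-⇔
           body-correct ψ (Agree-++ʳ (props φ) ag) (Pointwise-drop (choices φ) rd) i)
  body-correct (φ ∧ ψ) ag rd i =
    body-correct φ (Agree-++ˡ ag) (Pointwise-take (choices φ) rd) i
      ×-⇔ body-correct ψ (Agree-++ʳ (props φ) ag) (Pointwise-drop (choices φ) rd) i
  body-correct (A¹ φ) ag rd i = ltl-cong φ ag i
  body-correct (X φ) ag rd i = body-correct φ ag rd (suc i)
  body-correct (φ U ψ) {_ ∷ _} {_ ∷ _} ag (r ∷ rd) i =
    Until-cong (λ m → ≡-cong-⇔ (sym (r m)) ×-⇔ ltl-cong φ (Agree-++ˡ ag) m)
               (λ k → ≡-cong-⇔ (sym (r k)) ×-⇔ body-correct ψ (Agree-++ʳ (props φ) ag) rd k)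
  body-correct (φ W ψ) {_ ∷ _} {_ ∷ _} ag (r ∷ rd) i =
    Unless-cong (λ m → ≡-cong-⇔ (sym (r m)) ×-⇔ ltl-cong φ (Agree-++ˡ ag) m)
                (λ k → ≡-cong-⇔ (sym (r k)) ×-⇔ body-correct ψ (Agree-++ʳ (props φ) ag) rd k)

  -- Team satisfaction as the existence of uniform choices

  module _ (em : ExcludedMiddle (lsuc 0ℓ)) where

    TeamSat : ∀ φ → Traces → ℕ → Set
    TeamSat φ T i = ∃ λ e → ∀ t → t ∈ T → Sat φ e t i

    ⊨⇒Sat : ∀ φ → LeftFlat φ → ∀ {T i} → T , i ⊨ φ → TeamSat φ T i

    U⇒Sat : ∀ φ ψ → Flat φ → LeftFlat ψ → ∀ {T i} → T , i ⊨ φ U ψ → TeamSat (φ U ψ) T i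
    U⇒Sat φ ψ flat lf {T} {i} (k , i≤k , hψ , hφ) with ⊨⇒Sat ψ lf hψ
    -- The choice sequence is the indicator of the witness `k`, hence false at every `m < k`.
    ... | e , sat = (λ j → does (j ≟ k)) ∷ e , λ t t∈T →
      k , i≤k , (dec-true (k ≟ k) refl , sat t t∈T) ,
      λ m i≤m m<k → dec-false (m ≟ k) (<⇒≢ m<k) , to (Flat-ltl φ flat T m) (hφ m i≤m m<k) t t∈T

    ⊨⇒Sat (atom p)  lf (lift h) = [] , h
    ⊨⇒Sat (¬atom p) lf (lift h) = [] , h
    ⊨⇒Sat (φ ∨ ψ) lf (T₁ , T₂ , (_ , T⊆) , h₁ , h₂)
      with ⊨⇒Sat φ (LeftFlat-◁ ∨ˡ lf) h₁ | ⊨⇒Sat ψ (LeftFlat-◁ ∨ʳ lf) h₂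
    ... | e₁ , sat₁ | e₂ , sat₂ = e₁ ++ e₂ , λ t t∈T →
      ⊎-map (subst (λ e → Sat φ e t _) (sym (take-++ e₁ e₂)) ∘ sat₁ t)
            (subst (λ e → Sat ψ e t _) (sym (drop-++ e₁ e₂)) ∘ sat₂ t) (T⊆ t∈T)
    ⊨⇒Sat (φ ∨ᴮ ψ) lf (inj₁ h) with ⊨⇒Sat φ (LeftFlat-◁ ∨ᴮˡ lf) h
    -- The bit selects `φ`, so the choices for `ψ` are padding with an arbitrary value.
    ... | e , sat = const true ∷ e ++ replicate _ (const true) , λ t t∈T →
      inj₁ (refl , subst (λ e → Sat φ e t _) (sym (take-++ e _)) (sat t t∈T))
    ⊨⇒Sat (φ ∨ᴮ ψ) lf (inj₂ h) with ⊨⇒Sat ψ (LeftFlat-◁ ∨ᴮʳ lf) h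
    ... | e , sat = const false ∷ replicate (choices φ) (const true) ++ e , λ t t∈T →
      inj₂ (refl , subst (λ e → Sat ψ e t _) (sym (drop-++ (replicate (choices φ) _) e)) (sat t t∈T))
    ⊨⇒Sat (φ ∧ ψ) lf (h₁ , h₂)
      with ⊨⇒Sat φ (LeftFlat-◁ ∧ˡ lf) h₁ | ⊨⇒Sat ψ (LeftFlat-◁ ∧ʳ lf) h₂
    ... | e₁ , sat₁ | e₂ , sat₂ = e₁ ++ e₂ , λ t t∈T →
      subst (λ e → Sat φ e t _) (sym (take-++ e₁ e₂)) (sat₁ t t∈T) ,
      subst (λ e → Sat ψ e t _) (sym (drop-++ e₁ e₂)) (sat₂ t t∈T)
    ⊨⇒Sat (A¹ φ) lf h = [] , λ t t∈T → to (ltl-self φ t _) (h t t∈T)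
    ⊨⇒Sat (X φ) lf h = ⊨⇒Sat φ (LeftFlat-◁ Xᵃ lf) h
    ⊨⇒Sat (φ U ψ) lf h = U⇒Sat φ ψ (proj₁ (lf φ ψ) ε) (LeftFlat-◁ Uʳ lf) h
    -- A weak until splits classically: either it is an until and takes over its choices, or its
    -- left side holds forever and a constantly false sequence marks that no witness is chosen.
    ⊨⇒Sat (φ W ψ) lf {T} {i} h with em {T , i ⊨ φ U ψ}
    ... | yes u with U⇒Sat φ ψ (proj₂ (lf φ ψ) ε) (LeftFlat-◁ Wʳ lf) u
    ...   | s ∷ e , sat = s ∷ e , λ t t∈T → Until⇒Unless (sat t t∈T)
    ⊨⇒Sat (φ W ψ) lf {T} {i} h | no ¬u =
      const false ∷ replicate _ (const true) , λ t t∈T k i≤k →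
        inj₁ (refl , to (Flat-ltl φ (proj₂ (lf φ ψ) ε) T k) (Unless-¬Until h ¬u k i≤k) t t∈T)

    Sat⇒⊨ : ∀ φ → LeftFlat φ → ∀ {T i} e → (∀ t → t ∈ T → Sat φ e t i) → T , i ⊨ φ
    Sat⇒⊨ (atom p)  lf e sat = lift sat
    Sat⇒⊨ (¬atom p) lf e sat = lift sat
    Sat⇒⊨ (φ ∨ ψ) lf {T} {i} e sat =
      -- `Sat` lives in `Set`, unlike team satisfaction, so it can define a subteam. The two
      -- subteams may overlap.
      T ∩ (λ t → Sat φ (take (choices φ) e) t i) , T ∩ (λ t → Sat ψ (drop (choices φ) e) t i) ,
      ([ proj₁ , proj₁ ] , λ t∈T → ⊎-map (t∈T ,_) (t∈T ,_) (sat _ t∈T)) ,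
      Sat⇒⊨ φ (LeftFlat-◁ ∨ˡ lf) _ (λ _ → proj₂) , Sat⇒⊨ ψ (LeftFlat-◁ ∨ʳ lf) _ (λ _ → proj₂)
    -- The bit `s i` is the same for all traces, so the whole team takes one disjunct.
    Sat⇒⊨ (φ ∨ᴮ ψ) lf {i = i} (s ∷ e) sat with s i
    ... | true  = inj₁ (Sat⇒⊨ φ (LeftFlat-◁ ∨ᴮˡ lf) _ λ t t∈T →
                    [ proj₂ , (λ ()) ∘ proj₁ ]′ (sat t t∈T))
    ... | false = inj₂ (Sat⇒⊨ ψ (LeftFlat-◁ ∨ᴮʳ lf) _ λ t t∈T →
                    [ (λ ()) ∘ proj₁ , proj₂ ]′ (sat t t∈T))
    Sat⇒⊨ (φ ∧ ψ) lf e sat =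
      Sat⇒⊨ φ (LeftFlat-◁ ∧ˡ lf) _ (λ t → proj₁ ∘ sat t) ,
      Sat⇒⊨ ψ (LeftFlat-◁ ∧ʳ lf) _ (λ t → proj₂ ∘ sat t)
    Sat⇒⊨ (A¹ φ) lf e sat = λ t t∈T → from (ltl-self φ t _) (sat t t∈T)
    Sat⇒⊨ (X φ) lf e sat = Sat⇒⊨ φ (LeftFlat-◁ Xᵃ lf) e sat
    -- The common witness is read off some trace `t₀`, so the empty team is treated apart; `Lift`
    -- raises inhabitation to the level of `em`.
    Sat⇒⊨ (φ U ψ) lf {T} {i} (s ∷ e) sat with em {Lift _ (∃ λ t → t ∈ T)}
    ... | no ∅ = ⊨-∅ (φ U ψ) (λ t t∈T → ∅ (lift (t , t∈T)))
    ... | yes (lift (t₀ , t₀∈T)) with sat t₀ t₀∈T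
    ...   | k , i≤k , (sk , _) , before =
      k , i≤k ,
      -- The witness `l` of any other trace is also the first true position of `s` from `i` on, so
      -- `l` equals `k`. The same equation later turns `m < k` into `m < l`.
      Sat⇒⊨ ψ (LeftFlat-◁ Uʳ lf) e (λ t t∈T →
        let l , i≤l , (sl , satψ) , before′ = sat t t∈T
        in subst (Sat ψ e t)
                 (First-unique {s} (i≤l , sl , λ j i≤j → proj₁ ∘ before′ j i≤j) first-k) satψ) ,
      λ m i≤m m<k → from (Flat-ltl φ (proj₁ (lf φ ψ) ε) T m) λ t t∈T →
        let l , i≤l , (sl , _) , before′ = sat t t∈T
        in proj₂ (before′ m i≤m (subst (m <_)
             (First-unique {s} first-k (i≤l , sl , λ j i≤j → proj₁ ∘ before′ j i≤j)) m<k))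
      where
      first-k : First s i k
      first-k = i≤k , sk , λ j i≤j → proj₁ ∘ before j i≤j
    -- The bound `suc k` makes the search include `k` itself.
    Sat⇒⊨ (φ W ψ) lf {T} {i} (s ∷ e) sat k i≤k with first? s i (suc k)
    ... | inj₂ none = inj₁ (from (Flat-ltl φ (proj₂ (lf φ ψ) ε) T k) λ t t∈T →
      [ proj₂ , (λ { (m , i≤m , m≤k , sm , _) →
               contradiction (none m i≤m (s≤s m≤k)) (true≢false sm) }) ]′
        (sat t t∈T k i≤k))
    -- `sat` is queried at `j` rather than at `k`: the true bit there rules out the left
    -- alternative, and a witness `m ≤ j` cannot precede the first true position, so it is `j` for
    -- every trace.
    ... | inj₁ (j , s≤s j≤k , i≤j , sj , before) =
      inj₂ (j , i≤j , j≤k , Sat⇒⊨ ψ (LeftFlat-◁ Wʳ lf) e λ t t∈T →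
        [ (λ { (¬sj , _) → contradiction ¬sj (true≢false sj) })
        , (λ { (m , i≤m , m≤j , sm , satψ) →
               [ (λ m<j → contradiction (before m i≤m m<j) (true≢false sm))
               , (λ { refl → satψ }) ]′ (m≤n⇒m<n∨m≡n m≤j) }) ]′ (sat t t∈T j i≤j))

  -- Quantifier prefix

  close : Vec AP n → Matrix 1 → ∃*∀HyperQPTL
  close []       M = ∀π M
  close (q ∷ qs) M = ∃ᵘ q (close qs M)

  override : Vec AP n → Vec Seq n → Trace → Trace
  override []       []      t = t
  override (q ∷ qs) (s ∷ e) t = override qs e (t [ q ↦ s ])

  -- Each quantifier replaces the team by its image under an override, so induction on the prefix
  -- moves the overrides from the team to the individual trace.
  close-⊨ : ∀ (qs : Vec AP n) M T i →
            [] , i ⊨[ T ] close qs M ⇔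
            (∃ λ e → ∀ t → t ∈ T → (override qs e t ∷ []) , i ⊨ᴹ M)
  close-⊨ [] M T i = mk⇔ ([] ,_) (λ { ([] , h) → h })
  close-⊨ (q ∷ qs) M T i = mk⇔ ⇒ ⇐
    where
    ⇒ : [] , i ⊨[ T ] ∃ᵘ q (close qs M) → _
    ⇒ (s , h) with to (close-⊨ qs M _ i) h
    ... | e , sat = s ∷ e , λ t t∈T → sat _ (t , t∈T , refl)

    ⇐ : _ → [] , i ⊨[ T ] ∃ᵘ q (close qs M)
    ⇐ (s ∷ e , sat) = s , from (close-⊨ qs M _ i) (e , λ { _ (t , t∈T , refl) → sat t t∈T })

  [↦]-≡ : ∀ t q s i → (t [ q ↦ s ]) i q ≡ s i
  [↦]-≡ t q s i rewrite dec-true (q ≟ᴬ q) refl = refl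

  [↦]-≢ : ∀ t {p q} s i → p ≢ q → (t [ q ↦ s ]) i p ≡ t i p
  [↦]-≢ t {p} {q} s i p≢q rewrite dec-false (p ≟ᴬ q) p≢q = refl

  -- Fresh propositions and the resulting translation

  module _ (fresh : HasFresh AP) where

    freshNames : List AP → ∀ n → Vec AP n
    freshNames used zero    = []
    freshNames used (suc n) = proj₁ (fresh used) ∷ freshNames (proj₁ (fresh used) ∷ used) n

    override-used : ∀ used (e : Vec Seq n) t → Agree used t (override (freshNames used n) e t)
    override-used used []      t p∈ i = refl
    override-used used (s ∷ e) t p∈ i with fresh used
    ... | q , q∉ = trans (sym ([↦]-≢ t s i (λ { refl → q∉ p∈ })))
                         (override-used (q ∷ used) e (t [ q ↦ s ]) (there p∈) i)

    -- The head proposition counts as used for the remaining names, so by `override-used` the values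
    -- just written to it survive the later overrides.
    override-reads : ∀ used (e : Vec Seq n) t →
                     Reads (override (freshNames used n) e t) (freshNames used n) e
    override-reads used []      t = []
    override-reads used (s ∷ e) t with fresh used
    ... | q , _ =
      (λ i → trans (sym (override-used (q ∷ used) e (t [ q ↦ s ]) (here refl) i)) ([↦]-≡ t q s i))
        ∷ override-reads (q ∷ used) e (t [ q ↦ s ])

    names : ∀ φ → Vec AP (choices φ)
    names φ = freshNames (props φ) (choices φ)

    translate : TeamLTL → ∃*∀HyperQPTL
    translate φ = close (names φ) (body φ (names φ))

    -- `Sat` mediates: team satisfaction amounts to choices valid on every trace, and by `close-⊨`
    -- the prefix guesses exactly such choices.
    translate-correct : ExcludedMiddle (lsuc 0ℓ) → ∀ φ → LeftFlat φ → Equivalent φ (translate φ)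
    translate-correct em φ lf T i = ⇔-sym (close-⊨ (names φ) (body φ (names φ)) T i) ⇔-∘ mk⇔ ⇒ ⇐
      where
      correct : ∀ e t → Sat φ e t i ⇔ (override (names φ) e t ∷ []) , i ⊨ᴹ body φ (names φ)
      correct e t =
        body-correct φ (override-used (props φ) e t) (override-reads (props φ) e t) i

      ⇒ : T , i ⊨ φ → _
      ⇒ = map₂ (λ {e} sat t → to (correct e t) ∘ sat t) ∘ ⊨⇒Sat em φ lf

      ⇐ : (∃ λ e → ∀ t → t ∈ T → _) → T , i ⊨ φ
      ⇐ (e , sat) = Sat⇒⊨ em φ lf e (λ t → from (correct e t) ∘ sat t)

  -- Size

  size-close : ∀ (qs : Vec AP n) M → sizeᴴ (close qs M) ≡ n + suc (sizeᴹ M)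
  size-close []       M = refl
  size-close (q ∷ qs) M = cong suc (size-close qs M)

  size-ltl : ∀ φ → sizeᴹ (ltl φ) ≤ size φ
  size-ltl (atom p)  = ≤-refl
  size-ltl (¬atom p) = ≤-refl
  size-ltl (φ ∨ ψ)   = s≤s (+-mono-≤ (size-ltl φ) (size-ltl ψ))
  size-ltl (φ ∨ᴮ ψ)  = s≤s (+-mono-≤ (size-ltl φ) (size-ltl ψ))
  size-ltl (φ ∧ ψ)   = s≤s (+-mono-≤ (size-ltl φ) (size-ltl ψ))
  size-ltl (A¹ φ)    = m≤n⇒m≤1+n (size-ltl φ)
  size-ltl (X φ)     = s≤s (size-ltl φ)
  size-ltl (φ U ψ)   = s≤s (+-mono-≤ (size-ltl φ) (size-ltl ψ))
  size-ltl (φ W ψ)   = s≤s (+-mono-≤ (size-ltl φ) (size-ltl ψ))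

  choices≤size : ∀ φ → choices φ ≤ size φ
  choices≤size (atom p)  = z≤n
  choices≤size (¬atom p) = z≤n
  choices≤size (φ ∨ ψ)   = m≤n⇒m≤1+n (+-mono-≤ (choices≤size φ) (choices≤size ψ))
  choices≤size (φ ∨ᴮ ψ)  = s≤s (+-mono-≤ (choices≤size φ) (choices≤size ψ))
  choices≤size (φ ∧ ψ)   = m≤n⇒m≤1+n (+-mono-≤ (choices≤size φ) (choices≤size ψ))
  choices≤size (A¹ φ)    = z≤n
  choices≤size (X φ)     = m≤n⇒m≤1+n (choices≤size φ)
  choices≤size (φ U ψ)   = s≤s (m≤n⇒m≤o+n (size φ) (choices≤size ψ))
  choices≤size (φ W ψ)   = s≤s (m≤n⇒m≤o+n (size φ) (choices≤size ψ))

  1≤size : ∀ φ → 1 ≤ size φ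
  1≤size (atom p)  = s≤s z≤n
  1≤size (¬atom p) = s≤s z≤n
  1≤size (φ ∨ ψ)   = s≤s z≤n
  1≤size (φ ∨ᴮ ψ)  = s≤s z≤n
  1≤size (φ ∧ ψ)   = s≤s z≤n
  1≤size (A¹ φ)    = s≤s z≤n
  1≤size (X φ)     = s≤s z≤n
  1≤size (φ U ψ)   = s≤s z≤n
  1≤size (φ W ψ)   = s≤s z≤n

  private
    -- The source of the factor 5: one connective, plus a literal and a conjunction for each of the
    -- two guards.
    guarded : ∀ m n {k l} → k ≤ 5 * m → l ≤ 5 * n → 1 + (2 + k) + (2 + l) ≤ 5 * (1 + m + n)
    guarded m n {k} {l} k≤ l≤ = begin
      1 + (2 + k) + (2 + l)  ≡⟨ shift k l ⟩
      5 + (k + l)            ≤⟨ +-monoʳ-≤ 5 (+-mono-≤ k≤ l≤) ⟩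
      5 + (5 * m + 5 * n)    ≡⟨ distrib m n ⟩
      5 * (1 + m + n)        ∎
      where
      open ≤-Reasoning
      shift : ∀ k l → 1 + (2 + k) + (2 + l) ≡ 5 + (k + l)
      shift = solve-∀
      distrib : ∀ m n → 5 + (5 * m + 5 * n) ≡ 5 * (1 + m + n)
      distrib = solve-∀

    unguarded : ∀ m n {k l} → k ≤ 5 * m → l ≤ 5 * n → 1 + k + l ≤ 5 * (1 + m + n)
    unguarded m n k≤ l≤ =
      ≤-trans (+-mono-≤ (s≤s (m≤n⇒m≤o+n 2 ≤-refl)) (m≤n⇒m≤o+n 2 ≤-refl)) (guarded m n k≤ l≤)

    size-ltl-5 : ∀ φ → sizeᴹ (ltl φ) ≤ 5 * size φ
    size-ltl-5 φ = ≤-trans (size-ltl φ) (m≤n*m (size φ) 5)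

  size-body : ∀ φ qs → sizeᴹ (body φ qs) ≤ 5 * size φ
  size-body (atom p)  qs = s≤s z≤n
  size-body (¬atom p) qs = s≤s z≤n
  size-body (φ ∨ ψ)   qs = unguarded (size φ) (size ψ) (size-body φ _) (size-body ψ _)
  size-body (φ ∨ᴮ ψ) (q ∷ qs) = guarded (size φ) (size ψ) (size-body φ _) (size-body ψ _)
  size-body (φ ∧ ψ)   qs = unguarded (size φ) (size ψ) (size-body φ _) (size-body ψ _)
  size-body (A¹ φ)    qs = ≤-trans (size-ltl-5 φ) (*-monoʳ-≤ 5 (n≤1+n (size φ)))
  size-body (X φ)     qs = ≤-trans (s≤s (size-body φ qs)) (*-suc-≤ (size φ))
    where
    *-suc-≤ : ∀ m → suc (5 * m) ≤ 5 * suc m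
    *-suc-≤ m = ≤-trans (+-monoˡ-≤ (5 * m) (s≤s {n = 4} z≤n)) (≤-reflexive (sym (*-suc 5 m)))
  size-body (φ U ψ) (q ∷ qs) = guarded (size φ) (size ψ) (size-ltl-5 φ) (size-body ψ qs)
  size-body (φ W ψ) (q ∷ qs) = guarded (size φ) (size ψ) (size-ltl-5 φ) (size-body ψ qs)

  -- Per unit of size: one for the prefix quantifiers, five for the matrix, and one to absorb the
  -- single `∀π`.
  size-translate : ∀ fresh φ → sizeᴴ (translate fresh φ) ≤ 7 * size φ
  size-translate fresh φ = begin
    sizeᴴ (translate fresh φ)                        ≡⟨ size-close qs (body φ qs) ⟩
    choices φ + (1 + sizeᴹ (body φ qs))              ≤⟨ +-mono-≤ (choices≤size φ)
                                                          (+-mono-≤ (1≤size φ) (size-body φ qs)) ⟩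
    7 * size φ                                       ∎
    where
    open ≤-Reasoning
    qs = names fresh φ

theorem14 : (AP : Set) (_≟_ : DecidableEquality AP) → HasFresh AP →
    let open Logics AP _≟_ in
    Σ[ translate ∈ (TeamLTL → ∃*∀HyperQPTL) ] ∃[ c ]
    ((∀ φ → LeftFlat φ → sizeᴴ (translate φ) ≤ c * size φ)
    × (ExcludedMiddle (lsuc 0ℓ) → ∀ φ → LeftFlat φ → Equivalent φ (translate φ)))
theorem14 AP _≟_ fresh =
  translate fresh , 7 , (λ φ _ → size-translate fresh φ) , translate-correct fresh
  where open Translation AP _≟_
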